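{- Every fractionally tree-independence-number-fragile graph class is polynomially $(\mathsf{dgn},\omega)$-bounded.
   Context: All graphs are finite and simple. $\omega(G)$ is the clique number and $\alpha(G)$ the independence number of $G$. The degeneracy $\mathsf{dgn}(G)$ of a nonnull graph $G$ is the maximum, over nonnull induced subgraphs $H$ of $G$, of the minimum degree of $H$. A graph class $\mathcal{G}$ is polynomially $(\mathsf{dgn},\omega)$-bounded if there is a polynomial function $f$ such that $\mathsf{dgn}(H)\le f(\omega(H))$ for every $G\in\mathcal{G}$ and every (nonnull) induced subgraph $H$ of $G$. A tree decomposition of $G$ is a pair $(T,\{X_t\}_{t\in V(T)})$ with $T$ a tree and bags $X_t\subseteq V(G)$ such that every vertex is in some bag, both endpoints of every edge lie in a common bag, and for each $u\in V(G)$ the nodes $t$ with $u\in X_t$ induce a connected subgraph of $T$. The tree-independence number of $G$ is the minimum over tree decompositions of $\max_t\alpha(G[X_t])$. For $\beta\le 1$, a $\beta$-general cover of $G$ is a multiset $\mathcal{C}$ of subsets of $V(G)$ such that each vertex belongs to at least $\beta|\mathcal{C}|$ elements of $\mathcal{C}$. A class $\mathcal{G}$ is fractionally tree-independence-number-fragile if there is a function $f\colon\mathbb{N}\to\mathbb{N}$ such that, for every $r\in\mathbb{N}$, every $G\in\mathcal{G}$ has a $(1-1/r)$-general cover $\mathcal{C}$ such that $G[C]$ has tree-independence number at most $f(r)$ for every $C\in\mathcal{C}$. Here $\mathbb{N}=\{1,2,3,\ldots\}$, and covers are nonempty finite multisets. -}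

module Defs where

open import Data.Bool using (Bool; true; false; T; T?)
open import Data.Fin using (Fin; zero; suc; _≟_)
open import Data.Fin.Properties using (all?)
open import Data.Fin.Subset
  using (Subset; inside; outside; _∈_; ∣_∣; Nonempty)
open import Data.Fin.Subset.Properties using (_∈?_; nonempty?)
open import Data.Integer using (+_)
open import Data.List
  using (List; []; _∷_; [_]; _++_; _∷ʳ_; map; filter; length; foldr; allFin)
open import Data.List.Extrema.Nat using (max; min)
open import Data.List.Relation.Unary.All using (All)
open import Data.List.Relation.Unary.Linked using (Linked)
open import Data.List.Relation.Unary.Unique.Propositional using (Unique)
open import Data.Nat using (ℕ; zero; suc; _+_; _*_; _≤_; NonZero)
open import Data.Product using (∃-syntax; Σ-syntax; _×_)
open import Data.Rational as ℚ using (ℚ; 1ℚ; _/_)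
open import Data.Vec using ([]; _∷_; lookup; tabulate)
open import Level using (Level)
open import Relation.Binary.Construct.Closure.ReflexiveTransitive using (Star)
open import Relation.Binary.PropositionalEquality using (_≡_; _≢_)
open import Relation.Nullary using (¬_; Dec; ¬?; _→-dec_)

private
  variable
    ℓ : Level
    n : ℕ

------------------------------------------------------------------------
-- Finite simple graphs

record Graph : Set where
  field
    order      : ℕ
    adj        : Fin order → Fin order → Bool
    adj-sym    : ∀ u v → adj u v ≡ adj v u
    adj-irrefl : ∀ v → adj v v ≡ false

  Vertex : Set
  Vertex = Fin order

  Adj : Vertex → Vertex → Set
  Adj u v = T (adj u v)

  neighbours : Vertex → Subset order
  neighbours v = tabulate (adj v)

  degree : Vertex → ℕ
  degree v = ∣ neighbours v ∣

open Graph public using (order; Vertex; Adj; degree)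

-- The increasing enumeration of the elements of a subset.
embed : (S : Subset n) → Fin ∣ S ∣ → Fin n
embed (inside  ∷ S) zero    = zero
embed (inside  ∷ S) (suc i) = suc (embed S i)
embed (outside ∷ S) i       = suc (embed S i)

infix 9 _⟨_⟩

-- The induced subgraph G[S], with its vertices renumbered by `embed S`.
_⟨_⟩ : (G : Graph) → Subset (order G) → Graph
G ⟨ S ⟩ = record
  { order      = ∣ S ∣
  ; adj        = λ i j → Graph.adj G (embed S i) (embed S j)
  ; adj-sym    = λ i j → Graph.adj-sym G (embed S i) (embed S j)
  ; adj-irrefl = λ i → Graph.adj-irrefl G (embed S i)
  }

------------------------------------------------------------------------
-- Clique number, independence number, degeneracy

subsets : ∀ n → List (Subset n)
subsets zero    = [ [] ]
subsets (suc n) = map (outside ∷_) (subsets n) ++ map (inside ∷_) (subsets n)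

module _ (G : Graph) where

  IsClique : Subset (order G) → Set
  IsClique S = ∀ u v → u ∈ S → v ∈ S → u ≢ v → Adj G u v

  IsIndependent : Subset (order G) → Set
  IsIndependent S = ∀ u v → u ∈ S → v ∈ S → ¬ Adj G u v

  isClique? : ∀ S → Dec (IsClique S)
  isClique? S = all? λ u → all? λ v →
    u ∈? S →-dec v ∈? S →-dec ¬? (u ≟ v) →-dec T? (Graph.adj G u v)

  isIndependent? : ∀ S → Dec (IsIndependent S)
  isIndependent? S = all? λ u → all? λ v →
    u ∈? S →-dec v ∈? S →-dec ¬? (T? (Graph.adj G u v))

  -- The empty set is a clique and is independent, so the base value 0 of
  -- `max` never matters in ω and α.
  ω : ℕ
  ω = max 0 (map ∣_∣ (filter isClique? (subsets (order G))))

  α : ℕ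
  α = max 0 (map ∣_∣ (filter isIndependent? (subsets (order G))))

  -- Every degree is below the order, so on a nonnull graph the base value
  -- of `min` never matters.
  minDegree : ℕ
  minDegree = min (order G) (map (degree G) (allFin (order G)))

-- Meaningful for nonnull graphs; the base value makes it 0 on the null graph.
dgn : Graph → ℕ
dgn G = max 0 (map (λ S → minDegree (G ⟨ S ⟩))
                   (filter nonempty? (subsets (order G))))

------------------------------------------------------------------------
-- Polynomial (dgn,ω)-boundedness

-- The coefficients are listed from the constant term upwards.
evalPoly : List ℕ → ℕ → ℕ
evalPoly cs x = foldr (λ c y → c + x * y) 0 cs

-- Natural-number coefficients lose nothing for upper bounds: on ℕ, any real
-- polynomial is dominated by one whose coefficients are the absolute values
-- rounded up.
IsPolynomial : (ℕ → ℕ) → Set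
IsPolynomial f = ∃[ cs ] ∀ x → f x ≡ evalPoly cs x

PolynomiallyDgnωBounded : (Graph → Set ℓ) → Set ℓ
PolynomiallyDgnωBounded 𝒢 =
  ∃[ f ] IsPolynomial f ×
    (∀ G → 𝒢 G → ∀ (S : Subset (order G)) → Nonempty S →
       dgn (G ⟨ S ⟩) ≤ f (ω (G ⟨ S ⟩)))

------------------------------------------------------------------------
-- Tree-independence number

-- Vacuously true of the null graph.
Connected : Graph → Set
Connected G = ∀ u v → Star (Adj G) u v

-- The cycle v, v₁, …, vₖ, v of length k + 1 ≥ 3, given as v and v₁, …, vₖ.
IsCycle : (G : Graph) → Vertex G → List (Vertex G) → Set
IsCycle G v vs =
  2 ≤ length vs × Unique (v ∷ vs) × Linked (Adj G) ((v ∷ vs) ∷ʳ v)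

Acyclic : Graph → Set
Acyclic G = ∀ v vs → ¬ IsCycle G v vs

IsTree : Graph → Set
IsTree G = NonZero (order G) × Connected G × Acyclic G

record TreeDecomposition (G : Graph) : Set where
  field
    tree   : Graph
    isTree : IsTree tree
    bag    : Vertex tree → Subset (order G)

  nodesOf : Vertex G → Subset (order tree)
  nodesOf u = tabulate (λ t → lookup (bag t) u)

  field
    vertex-covered  : ∀ u → ∃[ t ] u ∈ bag t
    edge-covered    : ∀ u v → Adj G u v → ∃[ t ] (u ∈ bag t × v ∈ bag t)
    nodes-connected : ∀ u → Connected (tree ⟨ nodesOf u ⟩)

  independence : ℕ
  independence = max 0 (map (λ t → α (G ⟨ bag t ⟩)) (allFin (order tree)))

open TreeDecomposition public using (independence)

-- k is the minimum of `independence` over all tree decompositions of G.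
IsTreeIndependenceNumber : Graph → ℕ → Set
IsTreeIndependenceNumber G k =
  (∃[ D ] independence {G} D ≡ k) ×
  (∀ (D : TreeDecomposition G) → k ≤ independence D)

------------------------------------------------------------------------
-- Fractional tree-independence-number-fragility

multiplicity : Fin n → List (Subset n) → ℕ
multiplicity v 𝒞 = length (filter (v ∈?_) 𝒞)

-- Multisets are represented as lists, the order being irrelevant here.
IsGeneralCover : ℚ → (G : Graph) → List (Subset (order G)) → Set
IsGeneralCover β G 𝒞 =
  𝒞 ≢ [] ×
  (∀ v → β ℚ.* (+ length 𝒞 / 1) ℚ.≤ + multiplicity v 𝒞 / 1)

FractionallyTreeIndependenceNumberFragile : (Graph → Set ℓ) → Set ℓ
FractionallyTreeIndependenceNumberFragile 𝒢 =
  Σ[ f ∈ (ℕ → ℕ) ] ∀ (r : ℕ) .{{_ : NonZero r}} → ∀ G → 𝒢 G →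
    ∃[ 𝒞 ] IsGeneralCover (1ℚ ℚ.- + 1 / r) G 𝒞 ×
           All (λ C → ∃[ k ] IsTreeIndependenceNumber (G ⟨ C ⟩) k × k ≤ f r) 𝒞

{-# OPTIONS --safe #-}
module Submission where

-- By Ramsey's theorem, a set of vertices with clique number at most w and
-- independence number at most k has at most w + w² + … + wᵏ elements. Root the
-- tree of a decomposition and let home u be the topmost node whose bag contains
-- u: for every edge uv, v lies in the bag of home u or u in the bag of home v.
-- Hence a graph with clique number at most w and tree-independence number at most
-- k has an orientation whose outdegrees are at most the Ramsey bound d. In a
-- 2/3-general cover every edge lies inside at least a third of the members, so
-- that counting the oriented edges of all members gives an average degree of at
-- most 6d, in G and in each of its induced subgraphs.

open import Defs
open import Algebra.Properties.CommutativeSemigroup using (x∙yz≈y∙xz)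
open import Data.Bool using (Bool; true; false; if_then_else_; T; T?)
open import Data.Fin using (Fin; zero; suc; _≟_; fromℕ<)
open import Data.Fin.Properties using (any?; injective⇒≤; suc-injective; nonZeroIndex)
open import Data.Fin.Subset using (Subset; inside; outside; _∈_; ∣_∣; Nonempty)
open import Data.Fin.Subset.Properties using (_∈?_; nonempty?)
import Data.Integer as ℤ
import Data.Integer.Properties as ℤ
open import Data.List as List
  using (List; []; _∷_; _∷ʳ_; length; filter; allFin; replicate)
open import Data.List.Extrema.Nat using (max; max≤v⁺; v≤max⁺; min≤v⁺)
open import Data.List.Membership.DecPropositional using () renaming (_∈?_ to ∈L?)
import Data.List.Membership.Propositional as L
open import Data.List.Membership.Propositional.Properties
  using (∈-map⁺; ∈-++⁺ˡ; ∈-++⁺ʳ; ∈-filter⁺; ∈-allFin; ∈-lookup)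
open import Data.List.Properties using (length-tabulate)
open import Data.List.Relation.Binary.Sublist.Propositional
  using ([]; _∷_; ⊆-trans; minimum) renaming (_⊆_ to _⊑_; _∷ʳ_ to skip)
open import Data.List.Relation.Binary.Sublist.Propositional.Properties
  using (All-resp-⊆; filter-⊆)
open import Data.List.Relation.Unary.All as All using (All; []; _∷_)
open import Data.List.Relation.Unary.All.Properties using (all-filter; ¬Any⇒All¬)
import Data.List.Relation.Unary.All.Properties as All
open import Data.List.Relation.Unary.AllPairs using (AllPairs; []; _∷_)
open import Data.List.Relation.Unary.Any as Any using (here; there)
open import Data.List.Relation.Unary.Linked using (Linked; []; [-]; _∷_)
open import Data.List.Relation.Unary.Unique.Propositional using (Unique)
open import Data.List.Relation.Unary.Unique.Propositional.Properties using (allFin⁺)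
open import Data.Nat using (ℕ; zero; suc; _+_; _*_; _≤_; z≤n; s≤s; NonZero)
import Data.Nat as ℕ
import Data.Nat.Properties as ℕ
open import Data.Nat.Tactic.RingSolver using (solve-∀)
open import Data.Product using (∃-syntax; _×_; _,_; proj₁; proj₂)
open import Data.Rational as ℚ using (1ℚ; _/_)
import Data.Rational.Properties as ℚ
import Data.Rational.Unnormalised as ℚᵘ
import Data.Rational.Unnormalised.Properties as ℚᵘ
open import Data.Sum as Sum using (_⊎_; inj₁; inj₂; [_,_]′)
open import Data.Vec using ([]; _∷_; here; there; lookup; tabulate)
open import Data.Vec.Properties using (lookup∘tabulate; lookup⇒[]=; []=⇒lookup)
open import Function using (_∘_; id; flip; Injective)
open import Level using (Level; 0ℓ)
open import Relation.Binary using (Rel; Symmetric; _⇒_) renaming (Decidable to Decidable₂)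
open import Relation.Binary.Construct.Closure.ReflexiveTransitive
  using (Star; ε; _◅_; _◅◅_; gmap; reverse) renaming (map to mapStar)
open import Relation.Binary.PropositionalEquality
  using (_≡_; _≢_; refl; sym; trans; cong; cong₂; subst; subst₂; module ≡-Reasoning)
open import Relation.Nullary
  using (¬_; yes; no; does; contradiction; ¬?; _×-dec_; _⊎-dec_)
open import Relation.Nullary.Decidable using (dec-true)
open import Relation.Unary using (Pred; Decidable)

open import Algebra.Properties.Semiring.Sum ℕ.+-*-semiring
  using (sum-syntax; ∑-distrib-+; ∑-comm; *-distribˡ-sum; sum-cong-≗)

private
  variable
    A   : Set
    R S : Rel A 0ℓ
    m n : ℕ

-- Trees

-- The list holds the vertices after the starting one, the format in which `IsCycle` takes a cycle.
data Path {A : Set} (R : Rel A 0ℓ) : A → A → List A → Set where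
  []  : ∀ {x} → Path R x x []
  _∷_ : ∀ {x y z ys} → R x y → Path R y z ys → Path R x z (y ∷ ys)

Path-suffix : ∀ {x y z : A} {ys} → Path R y z ys → Unique (y ∷ ys) → x L.∈ y ∷ ys →
              ∃[ xs ] Path R x z xs × Unique (x ∷ xs)
Path-suffix p       u       (here refl) = _ , p , u
Path-suffix (_ ∷ p) (_ ∷ u) (there i)   = Path-suffix p u i

-- If the new first vertex already occurs on the simple path found for the rest, the suffix from
-- that occurrence on is taken instead.
simplePath : {R : Rel (Fin n) 0ℓ} {x y : Fin n} → Star R x y →
             ∃[ xs ] Path R x y xs × Unique (x ∷ xs)
simplePath ε = [] , [] , [] ∷ []
simplePath {x = x} (_◅_ {j = y} r s) with simplePath s
... | ys , p , u with ∈L? _≟_ x (y ∷ ys)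
...   | yes i = Path-suffix p u i
...   | no ∉  = y ∷ ys , r ∷ p , ¬Any⇒All¬ _ ∉ ∷ u

Path⇒Linked : ∀ {x y z : A} {xs} → R ⇒ S → Path R x y xs → S y z →
              Linked S ((x ∷ xs) ∷ʳ z)
Path⇒Linked f []      s = s ∷ [-]
Path⇒Linked f (r ∷ p) s = f r ∷ Path⇒Linked f p s

module _ (G : Graph) where

  adj-sym : ∀ {u v} → Adj G u v → Adj G v u
  adj-sym {u} {v} = subst T (Graph.adj-sym G u v)

  adj-irrefl : ∀ {u} → ¬ Adj G u u
  adj-irrefl {u} = subst T (Graph.adj-irrefl G u)

  -- `Leaving P` constrains only the target of a step, so that a walk of such steps may start in `P`
  -- but never visits `P` again.
  Within Leaving : Pred (Vertex G) 0ℓ → Rel (Vertex G) 0ℓ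
  Within  P x y = Adj G x y × P x × P y
  Leaving P x y = Adj G x y × ¬ P y

  -- Induction from the end of the walk: either a last visit to `P` is already known, or every
  -- vertex after the current one lies outside `P`, and the current one is the next candidate.
  lastVisit : ∀ {P} → Decidable P → ∀ {x y} → P x → Star (Adj G) x y →
              ∃[ z ] P z × Star (Leaving P) z y
  lastVisit {P} P? px s = [ id , (λ t → _ , px , t) ]′ (go s)
    where
    go : ∀ {x y} → Star (Adj G) x y →
         (∃[ z ] P z × Star (Leaving P) z y) ⊎ Star (Leaving P) x y
    go ε = inj₂ ε
    go (_◅_ {j = j} e s) with go s | P? j
    ... | inj₁ r | _     = inj₁ r
    ... | inj₂ t | yes p = inj₁ (j , p , t)
    ... | inj₂ t | no ¬p = inj₂ ((e , ¬p) ◅ t)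

  Leaving-returns⇒≡ : ∀ {P x y} → P y → Star (Leaving P) x y → x ≡ y
  Leaving-returns⇒≡ py ε = refl
  Leaving-returns⇒≡ py ((_ , ¬p) ◅ s) with refl ← Leaving-returns⇒≡ py s = contradiction py ¬p

  Avoiding : Vertex G → Rel (Vertex G) 0ℓ
  Avoiding a x y = Adj G x y × x ≢ a × y ≢ a

  Leaving⇒Avoiding : ∀ {P a x y} → P a → x ≢ a → Star (Leaving P) x y →
                     Star (Avoiding a) x y
  Leaving⇒Avoiding pa x≢a ε = ε
  Leaving⇒Avoiding {P} pa x≢a ((e , ¬p) ◅ s) =
    (e , x≢a , y≢a) ◅ Leaving⇒Avoiding pa y≢a s
    where
    y≢a : _ ≢ _
    y≢a refl = ¬p pa

  -- A simple `R`-path from `b` to `a` has at least two steps, since `a` and `b` differ and `R`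
  -- lacks the step from `b` to `a`. The edge `ab` would close it to a cycle.
  bridge : Acyclic G → ∀ {a b} → Adj G a b → R ⇒ Adj G → ¬ R b a → ¬ Star R b a
  bridge acyclic {a} {b} ab R⇒Adj ¬ba s with simplePath s
  ... | []             , []           , _ = adj-irrefl ab
  ... | _ ∷ []         , r ∷ []       , _ = ¬ba r
  ... | vs@(_ ∷ _ ∷ _) , p            , u =
    acyclic b vs (s≤s (s≤s z≤n) , u , Path⇒Linked R⇒Adj p ab)

  -- Otherwise the edge ab by which the walk leaves P for good at a lies on a
  -- cycle: from b on to r, back to c, through Q to x and through P to a.
  lastVisit-shared : Acyclic G → ∀ {P Q r x a c} → Decidable Q →
    Star (Within Q) c x → Star (Within P) x a →
    P a → Star (Leaving P) a r → Q c → Star (Leaving P) c r → Q a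
  -- Here `a` is the end `r` itself and lies in `P`, which forces `c` to equal `a`.
  lastVisit-shared acyclic Q? cx xa pa ε qc cr =
    subst _ (Leaving-returns⇒≡ pa cr) qc
  lastVisit-shared acyclic {P} {Q} {a = a} {c} Q? cx xa pa (_◅_ {j = b} (ab , ¬pb) br) qc cr
    with Q? a
  ... | yes qa = qa
  ... | no ¬qa = contradiction walk (bridge acyclic ab proj₁ λ (_ , ≢) → ≢ (refl , refl))
    where
    -- Only the step from `b` to `a` is forbidden. The first two pieces of `walk` avoid `a`, the
    -- third stays in `Q`, which misses `a`, and the last stays in `P`, which misses `b`.
    Other : Rel (Vertex G) 0ℓ
    Other x y = Adj G x y × ¬ (x ≡ b × y ≡ a)

    b≢a : b ≢ a
    b≢a refl = ¬pb pa

    c≢a : c ≢ a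
    c≢a refl = ¬qa qc

    avoiding : Avoiding a ⇒ Other
    avoiding (e , _ , y≢a) = e , y≢a ∘ proj₂

    walk : Star Other b a
    walk = mapStar avoiding (Leaving⇒Avoiding pa b≢a br)
        ◅◅ mapStar avoiding
             (reverse (λ (e , x≢a , y≢a) → adj-sym e , y≢a , x≢a) (Leaving⇒Avoiding pa c≢a cr))
        ◅◅ mapStar (λ { (e , _ , qa) → e , λ { (_ , refl) → ¬qa qa } }) cx
        ◅◅ mapStar (λ { (e , pb , _) → e , λ { (refl , _) → ¬pb pb } }) xa

-- Subsets and induced subgraphs

embed-injective : (S : Subset n) → Injective _≡_ _≡_ (embed S)
embed-injective (inside  ∷ S) {zero}  {zero}  eq = refl
embed-injective (inside  ∷ S) {suc i} {suc j} eq =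
  cong suc (embed-injective S (suc-injective eq))
embed-injective (outside ∷ S) eq = embed-injective S (suc-injective eq)

embed-∈ : (S : Subset n) (i : Fin ∣ S ∣) → embed S i ∈ S
embed-∈ (inside  ∷ S) zero    = here
embed-∈ (inside  ∷ S) (suc i) = there (embed-∈ S i)
embed-∈ (outside ∷ S) i       = there (embed-∈ S i)

∈⇒embed : {S : Subset n} {u : Fin n} → u ∈ S → ∃[ i ] embed S i ≡ u
∈⇒embed {S = inside  ∷ S} here      = zero , refl
∈⇒embed {S = inside  ∷ S} (there p) = let i , eq = ∈⇒embed p in suc i , cong suc eq
∈⇒embed {S = outside ∷ S} (there p) = let i , eq = ∈⇒embed p in i , cong suc eq

injective⇒≤∣∣ : {f : Fin m → Fin n} {S : Subset n} →
                Injective _≡_ _≡_ f → (∀ i → f i ∈ S) → m ≤ ∣ S ∣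
injective⇒≤∣∣ {f = f} inj f∈S = injective⇒≤ {f = proj₁ ∘ index} λ {i} {j} eq →
  inj (trans (sym (proj₂ (index i))) (trans (cong (embed _) eq) (proj₂ (index j))))
  where
  index : ∀ i → ∃[ k ] embed _ k ≡ f i
  index i = ∈⇒embed (f∈S i)

module _ {P : Pred (Fin n) 0ℓ} (P? : Decidable P) where

  comprehension : Subset n
  comprehension = tabulate (does ∘ P?)

  ∈-comprehension⁺ : ∀ {i} → P i → i ∈ comprehension
  ∈-comprehension⁺ {i} p =
    lookup⇒[]= i _ (trans (lookup∘tabulate _ i) (dec-true (P? i) p))

  ∈-comprehension⁻ : ∀ {i} → i ∈ comprehension → P i
  ∈-comprehension⁻ {i} i∈ with P? i | trans (sym (lookup∘tabulate (does ∘ P?) i)) ([]=⇒lookup i∈)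
  ... | yes p | _ = p

∈-subsets : (S : Subset n) → S L.∈ subsets n
∈-subsets []            = here refl
∈-subsets (outside ∷ S) = ∈-++⁺ˡ (∈-map⁺ _ (∈-subsets S))
∈-subsets (inside  ∷ S) = ∈-++⁺ʳ _ (∈-map⁺ _ (∈-subsets S))

-- Clique and independence numbers

module _ (G : Graph) where

  private
    N = order G

    ≤max-filter : {P : Pred (Subset N) 0ℓ} (P? : Decidable P) {S : Subset N} → P S →
                  ∣ S ∣ ≤ max 0 (List.map ∣_∣ (filter P? (subsets N)))
    ≤max-filter P? {S} p = v≤max⁺ 0 _
      (inj₂ (Any.map (λ { refl → ℕ.≤-refl }) (∈-map⁺ ∣_∣ (∈-filter⁺ P? (∈-subsets S) p))))

    hit? : (f : Fin m → Vertex G) → Decidable (λ v → ∃[ i ] f i ≡ v)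
    hit? f v = any? (λ i → f i ≟ v)

    image : (Fin m → Vertex G) → Subset N
    image f = comprehension (hit? f)

    ≤∣image∣ : (f : Fin m → Vertex G) → Injective _≡_ _≡_ f → m ≤ ∣ image f ∣
    ≤∣image∣ f inj = injective⇒≤∣∣ inj (λ i → ∈-comprehension⁺ (hit? f) (i , refl))

    image⁻ : (f : Fin m → Vertex G) → ∀ {v} → v ∈ image f → ∃[ i ] f i ≡ v
    image⁻ f = ∈-comprehension⁻ (hit? f)

  -- Injectivity of `f` follows from adjacency: distinct indices have adjacent, hence distinct,
  -- images.
  clique⇒≤ω : (f : Fin m → Vertex G) → (∀ {i j} → i ≢ j → Adj G (f i) (f j)) → m ≤ ω G
  clique⇒≤ω f clique = ℕ.≤-trans (≤∣image∣ f inj) (≤max-filter (isClique? G) isClique)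
    where
    inj : Injective _≡_ _≡_ f
    inj {i} {j} eq with i ≟ j
    ... | yes i≡j = i≡j
    ... | no  i≢j = contradiction (subst (λ v → Adj G v (f j)) eq (clique i≢j)) (adj-irrefl G)

    isClique : IsClique G (image f)
    isClique u v u∈ v∈ u≢v with image⁻ f u∈ | image⁻ f v∈
    ... | i , refl | j , refl = clique (u≢v ∘ cong f)

  independent⇒≤α : (f : Fin m → Vertex G) → Injective _≡_ _≡_ f →
                   (∀ i j → ¬ Adj G (f i) (f j)) → m ≤ α G
  independent⇒≤α f inj indep =
    ℕ.≤-trans (≤∣image∣ f inj) (≤max-filter (isIndependent? G) isIndependent)
    where
    isIndependent : IsIndependent G (image f)
    isIndependent u v u∈ v∈ with image⁻ f u∈ | image⁻ f v∈
    ... | i , refl | j , refl = indep i j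

-- Composable maps spare the renumbering of iterated induced subgraphs such as `G ⟨ S ⟩ ⟨ S′ ⟩` as
-- subsets of one graph.
record InducedEmbedding (G H : Graph) : Set where
  field
    to        : Vertex G → Vertex H
    injective : Injective _≡_ _≡_ to
    adj-to    : ∀ u v → Graph.adj H (to u) (to v) ≡ Graph.adj G u v

open InducedEmbedding

⟨⟩-embedding : (G : Graph) (S : Subset (order G)) → InducedEmbedding (G ⟨ S ⟩) G
⟨⟩-embedding G S = record
  { to        = embed S
  ; injective = embed-injective S
  ; adj-to    = λ _ _ → refl
  }

∘-embedding : ∀ {G H K} → InducedEmbedding H K → InducedEmbedding G H → InducedEmbedding G K
∘-embedding f g = record
  { to        = to f ∘ to g
  ; injective = injective g ∘ injective f
  ; adj-to    = λ u v → trans (adj-to f _ _) (adj-to g u v)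
  }

factor : ∀ {G H K} (e : InducedEmbedding H G) (f : InducedEmbedding K G) →
         (∀ u → ∃[ v ] to f v ≡ to e u) → InducedEmbedding H K
factor {G} {H} {K} e f lift = record
  { to        = proj₁ ∘ lift
  ; injective = λ {u} {v} eq → injective e
      (trans (sym (proj₂ (lift u))) (trans (cong (to f) eq) (proj₂ (lift v))))
  ; adj-to    = λ u v → begin
      Graph.adj K (proj₁ (lift u)) (proj₁ (lift v))
        ≡⟨ adj-to f _ _ ⟨
      Graph.adj G (to f (proj₁ (lift u))) (to f (proj₁ (lift v)))
        ≡⟨ cong₂ (Graph.adj G) (proj₂ (lift u)) (proj₂ (lift v)) ⟩
      Graph.adj G (to e u) (to e v)
        ≡⟨ adj-to e u v ⟩
      Graph.adj H u v ∎
  }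
  where open ≡-Reasoning

module _ {G H : Graph} (f : InducedEmbedding G H) where

  ω-mono : ω G ≤ ω H
  ω-mono = max≤v⁺ z≤n (All.map⁺ (All.map (λ {S} clique →
    clique⇒≤ω H (to f ∘ embed S) λ i≢j →
      subst T (sym (adj-to f _ _))
        (clique _ _ (embed-∈ S _) (embed-∈ S _) (i≢j ∘ embed-injective S)))
    (all-filter (isClique? G) (subsets (order G)))))

  α-mono : α G ≤ α H
  α-mono = max≤v⁺ z≤n (All.map⁺ (All.map (λ {S} indep →
    independent⇒≤α H (to f ∘ embed S) (embed-injective S ∘ injective f) λ i j →
      indep _ _ (embed-∈ S i) (embed-∈ S j) ∘ subst T (adj-to f _ _))
    (all-filter (isIndependent? G) (subsets (order G)))))

-- Ramsey's theorem

AllPairs-resp-⊑ : {xs ys : List A} → xs ⊑ ys → AllPairs R ys → AllPairs R xs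
AllPairs-resp-⊑ []         []      = []
AllPairs-resp-⊑ (skip y s) (_ ∷ p) = AllPairs-resp-⊑ s p
AllPairs-resp-⊑ (refl ∷ s) (r ∷ p) = All-resp-⊆ s r ∷ AllPairs-resp-⊑ s p

AllPairs-lookup : Symmetric R → {xs : List A} → AllPairs R xs → ∀ {i j} → i ≢ j →
                  R (List.lookup xs i) (List.lookup xs j)
AllPairs-lookup sy (r ∷ p) {zero}  {zero}  i≢j = contradiction refl i≢j
AllPairs-lookup sy (r ∷ p) {zero}  {suc j} i≢j = All.lookup r (∈-lookup j)
AllPairs-lookup sy (r ∷ p) {suc i} {zero}  i≢j = sy (All.lookup r (∈-lookup i))
AllPairs-lookup sy (r ∷ p) {suc i} {suc j} i≢j = AllPairs-lookup sy p (i≢j ∘ cong suc)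

-- w + w² + … + wᵏ
ramseyBound : ℕ → ℕ → ℕ
ramseyBound k w = w * evalPoly (replicate k 1) w

ramseyBound-suc : ∀ k w → ramseyBound k w ≤ ramseyBound k (suc w)
ramseyBound-suc zero    w = ℕ.*-monoˡ-≤ 0 (ℕ.n≤1+n w)
ramseyBound-suc (suc k) w = ℕ.*-mono-≤ (ℕ.n≤1+n w) (s≤s (ramseyBound-suc k w))

module _ {P : Pred A 0ℓ} (P? : Decidable P) where

  length-filter-∁ : ∀ xs →
    length xs ≤ length (filter P? xs) + length (filter (¬? ∘ P?) xs)
  length-filter-∁ []       = z≤n
  length-filter-∁ (x ∷ xs) with P? x
  ... | yes _ = s≤s (length-filter-∁ xs)
  ... | no  _ = ℕ.≤-trans (s≤s (length-filter-∁ xs)) (ℕ.≤-reflexive (sym (ℕ.+-suc _ _)))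

  ⊑-filter⇒All : ∀ xs {ys} → ys ⊑ filter P? xs → All P ys
  ⊑-filter⇒All xs s = All-resp-⊆ s (all-filter P? xs)

-- Split the tail by adjacency to the head `x`. Prepending `x` enlarges a clique among the
-- neighbours and an independent sublist among the others, so the former have the clique bound
-- lowered by one and the latter the independence bound.
ramsey : (R? : Decidable₂ R) → ∀ k w (xs : List A) →
  (∀ {ys} → ys ⊑ xs → AllPairs R ys → length ys ≤ w) →
  (∀ {ys} → ys ⊑ xs → AllPairs (λ x y → ¬ R x y) ys → length ys ≤ k) →
  length xs ≤ ramseyBound k w
ramsey R? k       w       []       _ _ = z≤n
ramsey R? zero    w       (x ∷ xs) clique indep
  with () ← indep (refl ∷ minimum xs) ([] ∷ [])
ramsey R? (suc k) zero    (x ∷ xs) clique indep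
  with () ← clique (refl ∷ minimum xs) ([] ∷ [])
ramsey R? (suc k) (suc w) (x ∷ xs) clique indep = s≤s (begin
  length xs
    ≤⟨ length-filter-∁ (R? x) xs ⟩
  length nbrs + length others
    ≡⟨ ℕ.+-comm (length nbrs) _ ⟩
  length others + length nbrs
    ≤⟨ ℕ.+-mono-≤
         (ramsey R? k (suc w) others
           (λ s → clique (skip x (⊆-trans s others⊑)))
           (λ s p → ℕ.s≤s⁻¹ (indep (refl ∷ ⊆-trans s others⊑) (⊑-filter⇒All (¬? ∘ R? x) xs s ∷ p))))
         (ramsey R? (suc k) w nbrs
           (λ s p → ℕ.s≤s⁻¹ (clique (refl ∷ ⊆-trans s nbrs⊑) (⊑-filter⇒All (R? x) xs s ∷ p)))
           (λ s → indep (skip x (⊆-trans s nbrs⊑)))) ⟩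
  -- By definition `ramseyBound (suc k) w` is `w * suc (ramseyBound k w)`. With `w` raised in the
  -- inner bound and the head counted, the sum is exactly `ramseyBound (suc k) (suc w)`.
  ramseyBound k (suc w) + ramseyBound (suc k) w
    ≤⟨ ℕ.+-monoʳ-≤ (ramseyBound k (suc w)) (ℕ.*-monoʳ-≤ w (s≤s (ramseyBound-suc k w))) ⟩
  ramseyBound k (suc w) + w * suc (ramseyBound k (suc w)) ∎)
  where
  open ℕ.≤-Reasoning
  nbrs others : List _
  nbrs   = filter (R? x) xs
  others = filter (¬? ∘ R? x) xs
  nbrs⊑ : nbrs ⊑ xs
  nbrs⊑ = filter-⊆ (R? x) xs
  others⊑ : others ⊑ xs
  others⊑ = filter-⊆ (¬? ∘ R? x) xs

order≤ramseyBound : ∀ G {k w} → α G ≤ k → ω G ≤ w → order G ≤ ramseyBound k w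
order≤ramseyBound G {k} {w} α≤k ω≤w =
  subst (_≤ ramseyBound k w) (length-tabulate id)
    (ramsey (λ u v → T? (Graph.adj G u v)) k w (allFin (order G))
      (λ _ p → ℕ.≤-trans (clique⇒≤ω G _ (AllPairs-lookup (adj-sym G) p)) ω≤w)
      (λ s p → ℕ.≤-trans (independent s p) α≤k))
  where
  independent : ∀ {ys} → ys ⊑ allFin (order G) → AllPairs (λ u v → ¬ Adj G u v) ys →
                length ys ≤ α G
  independent {ys} s p = independent⇒≤α G (List.lookup ys) inj indep
    where
    inj : Injective _≡_ _≡_ (List.lookup ys)
    inj {i} {j} eq with i ≟ j
    ... | yes i≡j = i≡j
    ... | no  i≢j = contradiction eq
      (AllPairs-lookup (_∘ sym) (AllPairs-resp-⊑ s (allFin⁺ _)) i≢j)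

    indep : ∀ i j → ¬ Adj G (List.lookup ys i) (List.lookup ys j)
    indep i j with i ≟ j
    ... | yes refl = adj-irrefl G
    ... | no  i≢j  = AllPairs-lookup (_∘ adj-sym G) p i≢j

-- Orienting the edges along a tree decomposition

-- `out u` may contain `u` and vertices not adjacent to it: it will be the part of a bag that lies
-- in the graph, and only its size and the edges inside `W` are counted.
record Orientation (G : Graph) (W : Pred (Vertex G) 0ℓ) (d : ℕ) : Set where
  field
    out     : Vertex G → Subset (order G)
    out≤    : ∀ u → ∣ out u ∣ ≤ d
    covered : ∀ {u v} → Adj G u v → W u → W v → v ∈ out u ⊎ u ∈ out v

open Orientation

module _ {G : Graph} (D : TreeDecomposition G) where

  open TreeDecomposition D hiding (independence)

  root : Vertex tree
  root = fromℕ< (ℕ.>-nonZero⁻¹ (order tree) {{proj₁ isTree}})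

  private
    Houses : Vertex G → Pred (Vertex tree) 0ℓ
    Houses u t = u ∈ bag t

    within-bags : ∀ u {s t} → Houses u s → Houses u t → Star (Within tree (Houses u)) s t
    within-bags u s∋u t∋u
      with ∈⇒embed (∈-nodesOf s∋u) | ∈⇒embed (∈-nodesOf t∋u)
      where
      ∈-nodesOf : ∀ {t} → Houses u t → t ∈ nodesOf u
      ∈-nodesOf {t} h = lookup⇒[]= t _ (trans (lookup∘tabulate _ t) ([]=⇒lookup h))
    ... | i , refl | j , refl =
      gmap (embed (nodesOf u)) (λ {x} {y} e → e , houses x , houses y) (nodes-connected u i j)
      where
      houses : ∀ i → Houses u (embed (nodesOf u) i)
      houses i = lookup⇒[]= u _
        (trans (sym (lookup∘tabulate (λ t → lookup (bag t) u) _))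
               ([]=⇒lookup (embed-∈ (nodesOf u) i)))

    home′ : ∀ u → ∃[ t ] Houses u t × Star (Leaving tree (Houses u)) t root
    home′ u = let t , t∋u = vertex-covered u in
      lastVisit tree (λ t → u ∈? bag t) t∋u (proj₁ (proj₂ isTree) t root)

  home : Vertex G → Vertex tree
  home u = proj₁ (home′ u)

  private
    shared : ∀ u v {t c} → Houses u t → Houses v t → Houses v c →
             Star (Leaving tree (Houses u)) c root → v ∈ bag (home u)
    -- The subtrees of `u` and `v` play the roles of `P` and `Q`, and `t` is their common node.
    shared u v t∋u t∋v c∋v s = let a , a∋u , as = home′ u in
      lastVisit-shared tree (proj₂ (proj₂ isTree)) (λ t → v ∈? bag t)
        (within-bags v c∋v t∋v) (within-bags u t∋u a∋u) a∋u as c∋v s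

  -- A walk from a node shared by u and v to the root leaves the union of the two
  -- subtrees for good at some c; the vertex whose subtree contains c is in the
  -- home bag of the other one.
  home-covers : ∀ u v → Adj G u v → v ∈ bag (home u) ⊎ u ∈ bag (home v)
  home-covers u v uv
    with t , t∋u , t∋v ← edge-covered u v uv
    with lastVisit tree (λ t → (u ∈? bag t) ⊎-dec (v ∈? bag t)) (inj₁ t∋u)
                   (proj₁ (proj₂ isTree) t root)
  ... | c , inj₁ c∋u , s = inj₂ (shared v u t∋v t∋u c∋u (mapStar (λ (e , ¬p) → e , ¬p ∘ inj₂) s))
  ... | c , inj₂ c∋v , s = inj₁ (shared u v t∋u t∋v c∋v (mapStar (λ (e , ¬p) → e , ¬p ∘ inj₁) s))

module _ {G H : Graph} (e : InducedEmbedding H G) {C : Subset (order G)}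
         (D : TreeDecomposition (G ⟨ C ⟩)) {k w : ℕ}
         (D≤k : independence D ≤ k) (ω≤w : ω H ≤ w) where

  open TreeDecomposition D using (tree; bag)

  private
    -- The root is a dummy value for the vertices outside C.
    node : ∀ u → ∃[ t ] (∀ i → embed C i ≡ to e u → home D i ≡ t)
    node u with any? (λ i → embed C i ≟ to e u)
    ... | yes (i , eq) =
      home D i , λ j eq′ → cong (home D) (embed-injective C (trans eq′ (sym eq)))
    ... | no ¬i = root D , λ i eq → contradiction (i , eq) ¬i

    InBag : Vertex tree → Pred (Vertex H) 0ℓ
    InBag t v = ∃[ i ] embed C i ≡ to e v × i ∈ bag t

    inBag? : ∀ t → Decidable (InBag t)
    inBag? t v = any? (λ i → (embed C i ≟ to e v) ×-dec (i ∈? bag t))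

    trace : Vertex tree → Subset (order H)
    trace t = comprehension (inBag? t)

    α-bag≤k : ∀ t → α ((G ⟨ C ⟩) ⟨ bag t ⟩) ≤ k
    α-bag≤k t = ℕ.≤-trans (v≤max⁺ 0 _
      (inj₂ (Any.map (λ { refl → ℕ.≤-refl }) (∈-map⁺ _ (∈-allFin t))))) D≤k

    -- The independence number is bounded inside the bag and the clique number inside `H`. Cutting
    -- the bag down to `H` makes both bounds available to Ramsey's theorem.
    ∣trace∣≤ : ∀ t → ∣ trace t ∣ ≤ ramseyBound k w
    ∣trace∣≤ t = order≤ramseyBound (H ⟨ trace t ⟩)
      (ℕ.≤-trans (α-mono into-bag) (α-bag≤k t))
      (ℕ.≤-trans (ω-mono (⟨⟩-embedding H (trace t))) ω≤w)
      where
      into-bag : InducedEmbedding (H ⟨ trace t ⟩) ((G ⟨ C ⟩) ⟨ bag t ⟩)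
      into-bag = factor
        (∘-embedding e (⟨⟩-embedding H (trace t)))
        (∘-embedding (⟨⟩-embedding G C) (⟨⟩-embedding (G ⟨ C ⟩) (bag t)))
        λ u → let i , eq , i∈ = ∈-comprehension⁻ (inBag? t) (embed-∈ (trace t) u)
                  j , eq′     = ∈⇒embed i∈
              in j , trans (cong (embed C) eq′) eq

  orientation : Orientation H (λ u → to e u ∈ C) (ramseyBound k w)
  orientation .out u  = trace (proj₁ (node u))
  orientation .out≤ u = ∣trace∣≤ (proj₁ (node u))
  orientation .covered {u} {v} uv u∈ v∈
    with i , eqᵢ ← ∈⇒embed u∈ | j , eqⱼ ← ∈⇒embed v∈ =
    Sum.map (in-trace i j eqᵢ eqⱼ) (in-trace j i eqⱼ eqᵢ)
      (home-covers D i j (subst T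
        (sym (trans (cong₂ (Graph.adj G) eqᵢ eqⱼ) (adj-to e u v))) uv))
    where
    in-trace : ∀ {u v} i j → embed C i ≡ to e u → embed C j ≡ to e v →
               j ∈ bag (home D i) → v ∈ trace (proj₁ (node u))
    in-trace {u} i j eqᵢ eqⱼ j∈ = ∈-comprehension⁺ (inBag? _)
      (j , eqⱼ , subst (λ t → j ∈ bag t) (proj₂ (node u) i eqᵢ) j∈)

-- Double counting

∑-mono : {f g : Fin n → ℕ} → (∀ i → f i ≤ g i) → ∑[ i < n ] f i ≤ ∑[ i < n ] g i
∑-mono {zero}  f≤g = z≤n
∑-mono {suc n} f≤g = ℕ.+-mono-≤ (f≤g zero) (∑-mono (f≤g ∘ suc))

∑-const : ∀ n c → ∑[ i < n ] c ≡ n * c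
∑-const zero    c = refl
∑-const (suc n) c = cong (c +_) (∑-const n c)

⟦_⟧ : Bool → ℕ
⟦ b ⟧ = if b then 1 else 0

∣∣≡∑ : (S : Subset n) → ∣ S ∣ ≡ ∑[ i < n ] ⟦ lookup S i ⟧
∣∣≡∑ []            = refl
∣∣≡∑ (inside  ∷ S) = cong suc (∣∣≡∑ S)
∣∣≡∑ (outside ∷ S) = ∣∣≡∑ S

multiplicity≡∑ : (v : Fin n) (𝒞 : List (Subset n)) →
  multiplicity v 𝒞 ≡ ∑[ c < length 𝒞 ] ⟦ lookup (List.lookup 𝒞 c) v ⟧
multiplicity≡∑ v []      = refl
multiplicity≡∑ v (C ∷ 𝒞) with v ∈? C | lookup C v in eq
... | yes _  | true  = cong suc (multiplicity≡∑ v 𝒞)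
... | no  _  | false = multiplicity≡∑ v 𝒞
... | yes v∈ | false = contradiction (trans (sym eq) ([]=⇒lookup v∈)) λ ()
... | no v∉  | true  = contradiction (lookup⇒[]= v C eq) v∉

degree≡∑ : ∀ G u → degree G u ≡ ∑[ v < order G ] ⟦ Graph.adj G u v ⟧
degree≡∑ G u = trans (∣∣≡∑ (Graph.neighbours G u))
  (sum-cong-≗ λ v → cong ⟦_⟧ (lookup∘tabulate (Graph.adj G u) v))

minDegree≤degree : ∀ G u → minDegree G ≤ degree G u
minDegree≤degree G u = min≤v⁺ (order G) _
  (inj₂ (Any.map (λ { refl → ℕ.≤-refl }) (∈-map⁺ (degree G) (∈-allFin u))))

module _ (G : Graph) {ℓ d : ℕ} (out : Fin ℓ → Vertex G → Subset (order G))
         (out≤d : ∀ c u → ∣ out c u ∣ ≤ d) where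

  private
    N = order G

    X : Vertex G → Vertex G → ℕ
    X u v = ∑[ c < ℓ ] ⟦ lookup (out c u) v ⟧

    ∑X≤ : ∑[ u < N ] ∑[ v < N ] X u v ≤ N * (ℓ * d)
    ∑X≤ = ℕ.≤-trans (∑-mono λ u → begin
        ∑[ v < N ] X u v
          ≡⟨ ∑-comm (λ v c → ⟦ lookup (out c u) v ⟧) ⟩
        ∑[ c < ℓ ] ∑[ v < N ] ⟦ lookup (out c u) v ⟧
          ≡⟨ sum-cong-≗ (λ c → ∣∣≡∑ (out c u)) ⟨
        ∑[ c < ℓ ] ∣ out c u ∣
          ≤⟨ ∑-mono (λ c → out≤d c u) ⟩
        ∑[ c < ℓ ] d
          ≡⟨ ∑-const ℓ d ⟩
        ℓ * d ∎)
      (ℕ.≤-reflexive (∑-const N (ℓ * d)))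
      where open ℕ.≤-Reasoning

  -- Sum the hypothesis over all ordered pairs of adjacent vertices. The left side becomes `ℓ` times
  -- the degree sum; on the right the two double sums agree and are each at most `N * (ℓ * d)`,
  -- whence the factor 3 times 2.
  minDegree≤6* : .{{NonZero ℓ}} → .{{NonZero N}} →
    (∀ u v → Adj G u v →
       ℓ ≤ 3 * (∑[ c < ℓ ] ⟦ lookup (out c u) v ⟧ + ∑[ c < ℓ ] ⟦ lookup (out c v) u ⟧)) →
    minDegree G ≤ 6 * d
  minDegree≤6* often = ℕ.*-cancelˡ-≤ N (ℕ.*-cancelˡ-≤ ℓ (begin
    ℓ * (N * minDegree G)
      ≡⟨ cong (ℓ *_) (∑-const N (minDegree G)) ⟨
    ℓ * (∑[ u < N ] minDegree G)
      ≤⟨ ℕ.*-monoʳ-≤ ℓ (∑-mono (minDegree≤degree G)) ⟩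
    ℓ * (∑[ u < N ] degree G u)
      ≡⟨ *-distribˡ-sum ℓ (degree G) ⟩
    ∑[ u < N ] (ℓ * degree G u)
      ≡⟨ sum-cong-≗ (λ u → trans (cong (ℓ *_) (degree≡∑ G u))
           (*-distribˡ-sum ℓ (λ v → ⟦ Graph.adj G u v ⟧))) ⟩
    ∑[ u < N ] ∑[ v < N ] (ℓ * ⟦ Graph.adj G u v ⟧)
      ≤⟨ ∑-mono (λ u → ∑-mono (often′ u)) ⟩
    ∑[ u < N ] ∑[ v < N ] (3 * (X u v + X v u))
      ≡⟨ trans (sum-cong-≗ λ u → sym (*-distribˡ-sum 3 (λ v → X u v + X v u)))
           (sym (*-distribˡ-sum 3 (λ u → ∑[ v < N ] (X u v + X v u)))) ⟩
    3 * (∑[ u < N ] ∑[ v < N ] (X u v + X v u))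
      ≡⟨ cong (3 *_) (trans (sum-cong-≗ λ u → ∑-distrib-+ (X u) (λ v → X v u))
           (∑-distrib-+ (λ u → ∑[ v < N ] X u v) (λ u → ∑[ v < N ] X v u))) ⟩
    3 * (∑[ u < N ] ∑[ v < N ] X u v + ∑[ u < N ] ∑[ v < N ] X v u)
      ≡⟨ cong (λ x → 3 * (∑[ u < N ] ∑[ v < N ] X u v + x)) (∑-comm (flip X)) ⟩
    3 * (∑[ u < N ] ∑[ v < N ] X u v + ∑[ u < N ] ∑[ v < N ] X u v)
      ≤⟨ ℕ.*-monoʳ-≤ 3 (ℕ.+-mono-≤ ∑X≤ ∑X≤) ⟩
    3 * (N * (ℓ * d) + N * (ℓ * d))
      ≡⟨ rearrange N ℓ d ⟩
    ℓ * (N * (6 * d)) ∎))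
    where
    open ℕ.≤-Reasoning
    rearrange : ∀ N ℓ d → 3 * (N * (ℓ * d) + N * (ℓ * d)) ≡ ℓ * (N * (6 * d))
    rearrange = solve-∀
    often′ : ∀ u v → ℓ * ⟦ Graph.adj G u v ⟧ ≤ 3 * (X u v + X v u)
    often′ u v with Graph.adj G u v | often u v
    ... | true  | h = ℕ.≤-trans (ℕ.≤-reflexive (ℕ.*-identityʳ ℓ)) (h _)
    ... | false | _ = ℕ.≤-trans (ℕ.≤-reflexive (ℕ.*-zeroʳ ℓ)) z≤n

-- From the cover condition to the degree bound

cover⇒2*≤3* : ∀ ℓ m → (1ℚ ℚ.- ℤ.+ 1 / 3) ℚ.* (ℤ.+ ℓ / 1) ℚ.≤ ℤ.+ m / 1 → 2 * ℓ ≤ 3 * m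
cover⇒2*≤3* ℓ m h = subst₂ _≤_ (ℕ.*-identityʳ (2 * ℓ)) (ℕ.*-comm m 3)
  (ℤ.drop‿+≤+ (subst₂ ℤ._≤_
    (trans (cong (ℤ._* ℤ.+ 1) (sym (ℤ.pos-* 2 ℓ))) (sym (ℤ.pos-* (2 * ℓ) 1)))
    (sym (ℤ.pos-* m 3))
    (ℚᵘ.drop-*≤* h′)))
  where
  open ℚᵘ.≤-Reasoning
  -- The second argument of `mkℚᵘ` is the denominator minus one, so this says that 2/3 times `ℓ` is
  -- at most `m`. Unnormalised fractions are compared by cross-multiplication, without reduction to
  -- lowest terms.
  h′ : ℚᵘ.mkℚᵘ (ℤ.+ 2) 2 ℚᵘ.* ℚᵘ.mkℚᵘ (ℤ.+ ℓ) 0 ℚᵘ.≤ ℚᵘ.mkℚᵘ (ℤ.+ m) 0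
  h′ = begin
    ℚᵘ.mkℚᵘ (ℤ.+ 2) 2 ℚᵘ.* ℚᵘ.mkℚᵘ (ℤ.+ ℓ) 0
      ≃⟨ ℚᵘ.*-congˡ (ℚ.toℚᵘ-fromℚᵘ (ℚᵘ.mkℚᵘ (ℤ.+ ℓ) 0)) ⟨
    ℚᵘ.mkℚᵘ (ℤ.+ 2) 2 ℚᵘ.* ℚ.toℚᵘ (ℤ.+ ℓ / 1)
      ≃⟨ ℚ.toℚᵘ-homo-* (1ℚ ℚ.- ℤ.+ 1 / 3) (ℤ.+ ℓ / 1) ⟨
    ℚ.toℚᵘ ((1ℚ ℚ.- ℤ.+ 1 / 3) ℚ.* (ℤ.+ ℓ / 1))
      ≤⟨ ℚ.toℚᵘ-mono-≤ h ⟩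
    ℚ.toℚᵘ (ℤ.+ m / 1)
      ≃⟨ ℚ.toℚᵘ-fromℚᵘ (ℚᵘ.mkℚᵘ (ℤ.+ m) 0) ⟩
    ℚᵘ.mkℚᵘ (ℤ.+ m) 0 ∎

-- Here `a` and `b` are to count the members of the cover that contain the two ends of an edge. Each
-- is at least two thirds of `ℓ`, which leaves a third for `x`, being at least `a + b - ℓ`.
edges-often-covered : ∀ {ℓ} a b x → 2 * ℓ ≤ 3 * a → 2 * ℓ ≤ 3 * b →
                      a + b ≤ ℓ + x → ℓ ≤ 3 * x
edges-often-covered {ℓ} a b x 2ℓ≤3a 2ℓ≤3b a+b≤ = ℕ.+-cancelˡ-≤ (3 * ℓ) _ _ (begin
  3 * ℓ + ℓ       ≡⟨ rearrange ℓ ⟩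
  2 * ℓ + 2 * ℓ   ≤⟨ ℕ.+-mono-≤ 2ℓ≤3a 2ℓ≤3b ⟩
  3 * a + 3 * b   ≡⟨ ℕ.*-distribˡ-+ 3 a b ⟨
  3 * (a + b)     ≤⟨ ℕ.*-monoʳ-≤ 3 a+b≤ ⟩
  3 * (ℓ + x)     ≡⟨ ℕ.*-distribˡ-+ 3 ℓ x ⟩
  3 * ℓ + 3 * x   ∎)
  where
  open ℕ.≤-Reasoning
  rearrange : ∀ ℓ → 3 * ℓ + ℓ ≡ 2 * ℓ + 2 * ℓ
  rearrange = solve-∀

nonZeroLength : {xs : List A} → xs ≢ [] → NonZero (length xs)
nonZeroLength {xs = []}    ≢[] = contradiction refl ≢[]
nonZeroLength {xs = _ ∷ _} _   = _

-- The cover and the tree decompositions belong to `G` and are pulled back along `e`, so that the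
-- bound depends on the clique number of `H` and not on that of `G`.
minDegree≤6*ramseyBound : ∀ {G H k w 𝒞} → .{{NonZero (order H)}} → InducedEmbedding H G →
  ω H ≤ w → IsGeneralCover (1ℚ ℚ.- ℤ.+ 1 / 3) G 𝒞 →
  All (λ C → ∃[ j ] IsTreeIndependenceNumber (G ⟨ C ⟩) j × j ≤ k) 𝒞 →
  minDegree H ≤ 6 * ramseyBound k w
minDegree≤6*ramseyBound {G} {H} {k} {w} {𝒞} e ω≤w (𝒞≢[] , covers) tins =
  minDegree≤6* H (out ∘ orient) (out≤ ∘ orient) {{nonZeroLength 𝒞≢[]}} often
  where
  ℓ = length 𝒞
  C : Fin ℓ → Subset (order G)
  C = List.lookup 𝒞

  orient : ∀ c → Orientation H (λ u → to e u ∈ C c) (ramseyBound k w)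
  -- `D` attains the tree-independence number of the member.
  orient c with _ , ((D , refl) , _) , D≤k ← All.lookup tins (∈-lookup {xs = 𝒞} c) =
    orientation e D D≤k ω≤w

  often : ∀ u v → Adj H u v →
    ℓ ≤ 3 * (∑[ c < ℓ ] ⟦ lookup (out (orient c) u) v ⟧ +
             ∑[ c < ℓ ] ⟦ lookup (out (orient c) v) u ⟧)
  often u v uv = edges-often-covered
    (multiplicity (to e u) 𝒞) (multiplicity (to e v) 𝒞) (∑[ c < ℓ ] X c + ∑[ c < ℓ ] Y c)
    (cover⇒2*≤3* ℓ (multiplicity (to e u) 𝒞) (covers (to e u)))
    (cover⇒2*≤3* ℓ (multiplicity (to e v) 𝒞) (covers (to e v))) (begin
    multiplicity (to e u) 𝒞 + multiplicity (to e v) 𝒞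
      ≡⟨ cong₂ _+_ (multiplicity≡∑ (to e u) 𝒞) (multiplicity≡∑ (to e v) 𝒞) ⟩
    ∑[ c < ℓ ] U c + ∑[ c < ℓ ] V c
      ≡⟨ ∑-distrib-+ U V ⟨
    ∑[ c < ℓ ] (U c + V c)
      ≤⟨ ∑-mono each ⟩
    ∑[ c < ℓ ] (1 + (X c + Y c))
      ≡⟨ ∑-distrib-+ (λ _ → 1) (λ c → X c + Y c) ⟩
    ∑[ c < ℓ ] 1 + ∑[ c < ℓ ] (X c + Y c)
      ≡⟨ cong₂ _+_ (trans (∑-const ℓ 1) (ℕ.*-identityʳ ℓ)) (∑-distrib-+ X Y) ⟩
    ℓ + (∑[ c < ℓ ] X c + ∑[ c < ℓ ] Y c) ∎)
    where
    open ℕ.≤-Reasoning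
    U V X Y : Fin ℓ → ℕ
    U c = ⟦ lookup (C c) (to e u) ⟧
    V c = ⟦ lookup (C c) (to e v) ⟧
    X c = ⟦ lookup (out (orient c) u) v ⟧
    Y c = ⟦ lookup (out (orient c) v) u ⟧

    -- A member with both ends of the edge gives 2 on the left, and its orientation adds at least 1
    -- to `X c + Y c`. Any other member gives at most 1 on the left.
    each : ∀ c → U c + V c ≤ 1 + (X c + Y c)
    each c with lookup (C c) (to e u) in equ | lookup (C c) (to e v) in eqv
    ... | false | false = z≤n
    ... | false | true  = s≤s z≤n
    ... | true  | false = s≤s z≤n
    ... | true  | true
      with covered (orient c) uv (lookup⇒[]= _ _ equ) (lookup⇒[]= _ _ eqv)
    ...   | inj₁ v∈ rewrite []=⇒lookup v∈ = s≤s (s≤s z≤n)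
    ...   | inj₂ u∈ rewrite []=⇒lookup u∈ = s≤s (ℕ.m≤n+m 1 _)

-- The polynomial bound

evalPoly-replicate-* : ∀ c k x → c * evalPoly (replicate k 1) x ≡ evalPoly (replicate k c) x
evalPoly-replicate-* c zero    x = ℕ.*-zeroʳ c
evalPoly-replicate-* c (suc k) x = begin
  c * (1 + x * p)     ≡⟨ ℕ.*-distribˡ-+ c 1 (x * p) ⟩
  c * 1 + c * (x * p) ≡⟨ cong₂ _+_ (ℕ.*-identityʳ c) (x∙yz≈y∙xz ℕ.*-commutativeSemigroup c x p) ⟩
  c + x * (c * p)     ≡⟨ cong (λ q → c + x * q) (evalPoly-replicate-* c k x) ⟩
  c + x * evalPoly (replicate k c) x ∎
  where
  open ≡-Reasoning
  p = evalPoly (replicate k 1) x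

corollary6p7 : {ℓ : Level} (𝒢 : Graph → Set ℓ) →
    FractionallyTreeIndependenceNumberFragile 𝒢 → PolynomiallyDgnωBounded 𝒢
corollary6p7 𝒢 (f , fragile) = evalPoly cs , (cs , λ _ → refl) , bounded
  where
  -- Taking `r = 3` gives 2/3-general covers. As `k` depends on the class alone, so does the
  -- polynomial.
  k = f 3
  -- The coefficients of six times the Ramsey bound, which has no constant term.
  cs = 0 ∷ replicate k 6

  bounded : ∀ G → 𝒢 G → ∀ S → _ → dgn (G ⟨ S ⟩) ≤ evalPoly cs (ω (G ⟨ S ⟩))
  bounded G G∈𝒢 S _ with 𝒞 , cover , tins ← fragile 3 G G∈𝒢 =
    max≤v⁺ z≤n (All.map⁺ (All.map (λ {S′} → minDegree≤ S′)
      (all-filter nonempty? (subsets (order (G ⟨ S ⟩))))))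
    where
    w = ω (G ⟨ S ⟩)

    minDegree≤ : ∀ S′ → Nonempty S′ → minDegree (G ⟨ S ⟩ ⟨ S′ ⟩) ≤ evalPoly cs w
    minDegree≤ S′ (_ , u∈S′) = begin
      minDegree (G ⟨ S ⟩ ⟨ S′ ⟩)
        ≤⟨ minDegree≤6*ramseyBound {{nonZeroIndex (proj₁ (∈⇒embed u∈S′))}}
             (∘-embedding (⟨⟩-embedding G S) (⟨⟩-embedding (G ⟨ S ⟩) S′))
             (ω-mono (⟨⟩-embedding (G ⟨ S ⟩) S′)) cover tins ⟩
      6 * (w * evalPoly (replicate k 1) w)
        ≡⟨ x∙yz≈y∙xz ℕ.*-commutativeSemigroup 6 w _ ⟩
      w * (6 * evalPoly (replicate k 1) w)
        ≡⟨ cong (w *_) (evalPoly-replicate-* 6 k w) ⟩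
      evalPoly cs w ∎
      where open ℕ.≤-Reasoning
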